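{- Let $a,b$ be integers with $3\le a\le b$, let $G=K_{a,b}$ be the complete bipartite graph, and for every integer $k\ge 0$ let $p_k=\ddot{\gamma}_P^k(G)$. Then for every $k\ge 0$, \[ p_{k+1}=\begin{cases} p_k+2 & \text{if } (k,p_k) \text{ satisfies the Jump Condition for } K_{a,b},\\ p_k+1 & \text{otherwise.}\end{cases} \]
   Context: All graphs are finite, simple, undirected, with nonempty vertex set. For $S\subseteq V(G)$ the power domination process is: (1) start with the observed set $N[S]$ (the union of closed neighborhoods of vertices of $S$); (2) while some observed vertex has exactly one unobserved neighbor $w$, add $w$ to the observed set. $S$ is a power dominating set if eventually all vertices are observed. For an integer $k\ge 0$, a multiset $S$ of vertices of $G$ is a $k$-PMU-defect-robust power dominating set ($k$-rPDS) if $|S|\ge k$ and for every submultiset $F$ of $S$ with $|F|=k$, the underlying set of $S\setminus F$ (multiset difference) contains a power dominating set of $G$. Cardinalities of multisets count multiplicity. $\ddot{\gamma}_P^k(G)$ is the minimum cardinality of a $k$-rPDS of $G$. Jump Condition: given integers $3\le a\le b$, $k\ge 0$ and $p_k=\ddot{\gamma}_P^k(K_{a,b})$, the pair $(k,p_k)$ satisfies the Jump Condition for $K_{a,b}$ if there exist nonnegative integers $q_a,r_a,q_b,r_b$ with $p_k=q_aa+r_a+q_bb+r_b$ such that (1) $q_aa+r_a+2q_b-1=k$; (2) $q_bb+r_b+2q_a-1=k$; (3) $r_a\le a-3$; (4) $r_b\le b-3$. -}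

module Defs where

open import Data.Empty using (⊥-elim)
open import Data.Fin using (Fin; zero; suc; splitAt)
open import Data.Fin.Properties using (any?; all?) renaming (_≟_ to _≟ᶠ_)
open import Data.Fin.Subset using (Subset; _∈_; _∉_; _⊆_; _∪_; ⁅_⁆; ∣_∣; ⊤)
open import Data.Fin.Subset.Properties
  using (_∈?_; _⊆?_; anySubset?; ⊆⊤; ⊆-antisym; ∈⊤; p⊆p∪q; q⊆p∪q; x∈p∪q⁻;
         x∈⁅x⁆; x∈⁅y⁆⇒x≡y; p⊂q⇒∣p∣<∣q∣; ∣p∣≤n)
open import Data.Nat
  using (ℕ; zero; suc; _+_; _*_; _∸_; _≤_; _<_; z≤n; s≤s; s≤s⁻¹; NonZero; _≤?_; _<?_)
open import Data.Nat.Properties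
  using (_≟_; anyUpTo?; m+n∸m≡n; m+[n∸m]≡n; m≤m+n; m≤n+m; ≤-trans; ≤-refl; ≤-reflexive;
         n≤1+n; m<n⇒0<n∸m; ∸-monoʳ-<)
open import Data.Product using (∃; ∃-syntax; _×_; _,_; proj₁)
open import Data.Sum using (_⊎_; inj₁; inj₂)
open import Data.Vec using (Vec; []; _∷_; lookup; tabulate; zipWith; replicate; sum; map)
open import Data.Vec.Properties
  using (lookup⇒[]=; []=⇒lookup; lookup∘tabulate; lookup-map; lookup-zipWith; lookup-replicate)
open import Data.Vec.Relation.Binary.Pointwise.Inductive as Pointwise using (Pointwise)
open import Relation.Binary using (Rel; Decidable; Symmetric)
open import Relation.Binary.Construct.Closure.ReflexiveTransitive using (Star; ε; _◅_)
open import Relation.Binary.PropositionalEquality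
  using (_≡_; refl; sym; trans; cong; subst)
open import Relation.Nullary using (Dec; yes; no; ¬_; does; contradiction)
open import Relation.Nullary.Decidable
  using (map′; _×-dec_; _⊎-dec_; _→-dec_; ¬?; decidable-stable; dec-true)
import Relation.Unary as U
open import Level using (0ℓ)

record Graph : Set₁ where
  field
    order        : ℕ
    .{{nonEmpty}} : NonZero order
    Adj          : Rel (Fin order) 0ℓ
    adj?         : Decidable Adj
    adj-sym      : Symmetric Adj
    adj-irrefl   : ∀ {v} → ¬ Adj v v

  Vertex : Set
  Vertex = Fin order

data Opposite {A B : Set} : Rel (A ⊎ B) 0ℓ where
  lr : ∀ {x y} → Opposite (inj₁ x) (inj₂ y)
  rl : ∀ {x y} → Opposite (inj₂ y) (inj₁ x)

opposite? : ∀ {A B : Set} → Decidable (Opposite {A} {B})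
opposite? (inj₁ _) (inj₁ _) = no λ ()
opposite? (inj₁ _) (inj₂ _) = yes lr
opposite? (inj₂ _) (inj₁ _) = yes rl
opposite? (inj₂ _) (inj₂ _) = no λ ()

opposite-sym : ∀ {A B : Set} → Symmetric (Opposite {A} {B})
opposite-sym lr = rl
opposite-sym rl = lr

opposite-irrefl : ∀ {A B : Set} {s : A ⊎ B} → ¬ Opposite s s
opposite-irrefl {s = inj₁ _} ()
opposite-irrefl {s = inj₂ _} ()

+-nonZeroˡ : ∀ a b .{{_ : NonZero a}} → NonZero (a + b)
+-nonZeroˡ (suc a) b = _

-- Vertices 0, …, a-1 form one side and a, …, a+b-1 the other.
completeBipartite : (a b : ℕ) .{{_ : NonZero a}} → Graph
completeBipartite a b = record
  { order      = a + b
  ; nonEmpty   = +-nonZeroˡ a b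
  ; Adj        = λ u v → Opposite (splitAt a u) (splitAt a v)
  ; adj?       = λ u v → opposite? (splitAt a u) (splitAt a v)
  ; adj-sym    = opposite-sym
  ; adj-irrefl = opposite-irrefl
  }

module _ {n : ℕ} {P : U.Pred (Fin n) 0ℓ} where

  comprehension : U.Decidable P → Subset n
  comprehension P? = tabulate (λ v → does (P? v))

  ∈-comprehension⁺ : (P? : U.Decidable P) → ∀ {v} → P v → v ∈ comprehension P?
  ∈-comprehension⁺ P? {v} pv =
    lookup⇒[]= v _ (trans (lookup∘tabulate _ v) (dec-true (P? v) pv))

  ∈-comprehension⁻ : (P? : U.Decidable P) → ∀ {v} → v ∈ comprehension P? → P v
  ∈-comprehension⁻ P? {v} v∈
    with P? v | trans (sym (lookup∘tabulate (λ v → does (P? v)) v)) ([]=⇒lookup v∈)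
  ... | yes pv | _  = pv
  ... | no  _  | ()

module _ (G : Graph) where
  open Graph G

  InClosedNbhd : Subset order → Vertex → Set
  InClosedNbhd S w = w ∈ S ⊎ ∃[ v ] (v ∈ S × Adj v w)

  inClosedNbhd? : ∀ S → U.Decidable (InClosedNbhd S)
  inClosedNbhd? S w = (w ∈? S) ⊎-dec any? (λ v → (v ∈? S) ×-dec adj? v w)

  N[_] : Subset order → Subset order
  N[ S ] = comprehension (inClosedNbhd? S)

  UniqueUnobservedNbr : Subset order → Vertex → Vertex → Set
  UniqueUnobservedNbr O v w =
    (Adj v w × w ∉ O) × (∀ u → Adj v u → u ∉ O → u ≡ w)

  data _⟶_ (O : Subset order) : Subset order → Set where
    force : ∀ {v w} → v ∈ O → UniqueUnobservedNbr O v w → O ⟶ (O ∪ ⁅ w ⁆)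

  -- The order of forcing is immaterial: by ⟶*-mono below, if one run from N[ S ]
  -- observes every vertex, then any other run can be continued until it does.
  PowerDominating : Subset order → Set
  PowerDominating S = Star _⟶_ N[ S ] ⊤

-- A multiset is the vector of its multiplicities.
Multiset : ℕ → Set
Multiset n = Vec ℕ n

infix 4 _≼_
infixl 6 _∖_

card : ∀ {n} → Multiset n → ℕ
card = sum

_≼_ : ∀ {n} → Rel (Multiset n) 0ℓ
_≼_ = Pointwise _≤_

_∖_ : ∀ {n} → Multiset n → Multiset n → Multiset n
_∖_ = zipWith _∸_

support : ∀ {n} → Multiset n → Subset n
support = map (λ m → does (0 <? m))

module _ (G : Graph) where
  open Graph G

  ContainsPowerDominating : Subset order → Set
  ContainsPowerDominating U = ∃[ T ] (T ⊆ U × PowerDominating G T)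

  IsRobust : ℕ → Multiset order → Set
  IsRobust k S =
    k ≤ card S ×
    (∀ F → F ≼ S → card F ≡ k → ContainsPowerDominating (support (S ∖ F)))

  RobustSize : ℕ → ℕ → Set
  RobustSize k m = ∃[ S ] (card S ≡ m × IsRobust k S)

IsLeast : (ℕ → Set) → ℕ → Set
IsLeast P m = P m × (∀ j → P j → m ≤ j)

least : ∀ {P : ℕ → Set} → U.Decidable P → ∀ m → P m → ∃ (IsLeast P)
least P? zero p = zero , p , λ _ _ → z≤n
least {P} P? (suc m) p with P? 0
... | yes p₀ = zero , p₀ , λ _ _ → z≤n
... | no ¬p₀ with least (λ j → P? (suc j)) m p
...   | n , pn , min = suc n , pn , min′
  where
  min′ : ∀ j → P j → suc n ≤ j
  min′ zero    p₀ = contradiction p₀ ¬p₀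
  min′ (suc j) pj = s≤s (min j pj)

anyOfCard? : ∀ {n} {P : Multiset n → Set} → U.Decidable P →
             ∀ k → Dec (∃[ F ] (card F ≡ k × P F))
anyOfCard? {zero} P? k =
  map′ (λ { (e , p) → [] , e , p }) (λ { ([] , e , p) → e , p }) ((0 ≟ k) ×-dec P? [])
anyOfCard? {suc n} {P} P? k = map′ to from
  (anyUpTo? (λ i → anyOfCard? (λ F → P? (i ∷ F)) (k ∸ i)) (suc k))
  where
  Split : Set
  Split = ∃[ i ] (i < suc k × ∃[ F ] (card F ≡ k ∸ i × P (i ∷ F)))

  to : Split → ∃[ F ] (card F ≡ k × P F)
  to (i , i≤k , F , e , p) =
    i ∷ F , trans (cong (i +_) e) (m+[n∸m]≡n (s≤s⁻¹ i≤k)) , p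

  from : ∃[ F ] (card F ≡ k × P F) → Split
  from (i ∷ F , refl , p) = i , s≤s (m≤m+n i (sum F)) , F , sym (m+n∸m≡n i (sum F)) , p

module _ (G : Graph) where
  open Graph G

  private
    infix 3 _⟶ᴳ_ _⟶*_

    _⟶ᴳ_ : Rel (Subset order) 0ℓ
    _⟶ᴳ_ = _⟶_ G

    _⟶*_ : Rel (Subset order) 0ℓ
    _⟶*_ = Star _⟶ᴳ_

    ∪-least : ∀ {p q r : Subset order} → p ⊆ r → q ⊆ r → p ∪ q ⊆ r
    ∪-least {p} {q} p⊆r q⊆r x∈ with x∈p∪q⁻ p q x∈
    ... | inj₁ x∈p = p⊆r x∈p
    ... | inj₂ x∈q = q⊆r x∈q

    ∪-monoˡ : ∀ {p q : Subset order} r → p ⊆ q → p ∪ r ⊆ q ∪ r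
    ∪-monoˡ {q = q} r p⊆q = ∪-least (λ x∈p → p⊆p∪q r (p⊆q x∈p)) (q⊆p∪q q r)

    ⁅⁆⊆ : ∀ {w} {p : Subset order} → w ∈ p → ⁅ w ⁆ ⊆ p
    ⁅⁆⊆ {w} {p} w∈p x∈ = subst (_∈ p) (sym (x∈⁅y⁆⇒x≡y w x∈)) w∈p

  ⟶*-mono : ∀ {O P} → O ⊆ P → O ⟶* ⊤ → P ⟶* ⊤
  ⟶*-mono {P = P} ⊤⊆P ε = subst (_⟶* ⊤) (⊆-antisym ⊤⊆P ⊆⊤) ε
  ⟶*-mono {P = P} O⊆P (force {v} {w} v∈O ((vw , _) , unique) ◅ rest) with w ∈? P
  ... | yes w∈P = ⟶*-mono (∪-least O⊆P (⁅⁆⊆ w∈P)) rest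
  ... | no  w∉P =
    force (O⊆P v∈O) ((vw , w∉P) , λ u vu u∉P → unique u vu (λ u∈O → u∉P (O⊆P u∈O)))
    ◅ ⟶*-mono (∪-monoˡ ⁅ w ⁆ O⊆P) rest

  canForce? : ∀ O → Dec (∃[ v ] ∃[ w ] (v ∈ O × UniqueUnobservedNbr G O v w))
  canForce? O = any? λ v → any? λ w →
    (v ∈? O) ×-dec ((adj? v w ×-dec ¬? (w ∈? O)) ×-dec
    all? (λ u → adj? v u →-dec (¬? (u ∈? O) →-dec (u ≟ᶠ w))))

  private
    reaches? : ∀ fuel O → order ∸ ∣ O ∣ < fuel → Dec (O ⟶* ⊤)
    reaches? (suc fuel) O (s≤s bound) with canForce? O
    ... | yes (v , w , v∈O , unique@((_ , w∉O) , _)) =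
      map′ (force v∈O unique ◅_) (⟶*-mono (p⊆p∪q ⁅ w ⁆))
        (reaches? fuel (O ∪ ⁅ w ⁆) (≤-trans smaller bound))
      where
      smaller : order ∸ ∣ O ∪ ⁅ w ⁆ ∣ < order ∸ ∣ O ∣
      smaller = ∸-monoʳ-<
        (p⊂q⇒∣p∣<∣q∣ (p⊆p∪q ⁅ w ⁆ , w , q⊆p∪q O ⁅ w ⁆ (x∈⁅x⁆ w) , w∉O))
        (∣p∣≤n (O ∪ ⁅ w ⁆))
    ... | no stuck = map′ full⇒ ⇒full (⊤ ⊆? O)
      where
      full⇒ : ⊤ ⊆ O → O ⟶* ⊤
      full⇒ ⊤⊆O = ⟶*-mono ⊤⊆O ε

      ⇒full : O ⟶* ⊤ → ⊤ ⊆ O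
      ⇒full ε                      = λ x∈ → x∈
      ⇒full (force v∈O unique ◅ _) = ⊥-elim (stuck (_ , _ , v∈O , unique))

  powerDominating? : U.Decidable (PowerDominating G)
  powerDominating? S = reaches? (suc (order ∸ ∣ N[_] G S ∣)) (N[_] G S) ≤-refl

  isRobust? : ∀ k → U.Decidable (IsRobust G k)
  isRobust? k S = (k ≤? card S) ×-dec
    map′ to from (¬? (anyOfCard? (λ F → (Pointwise.decidable _≤?_ F S) ×-dec ¬? (good? F)) k))
    where
    Good : Multiset order → Set
    Good F = ContainsPowerDominating G (support (S ∖ F))

    good? : U.Decidable Good
    good? F = anySubset? (λ T → (T ⊆? support (S ∖ F)) ×-dec powerDominating? T)

    to : ¬ (∃[ F ] (card F ≡ k × F ≼ S × ¬ Good F)) → ∀ F → F ≼ S → card F ≡ k → Good F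
    to none F F≼S e = decidable-stable (good? F) (λ bad → none (F , e , F≼S , bad))

    from : (∀ F → F ≼ S → card F ≡ k → Good F) → ¬ (∃[ F ] (card F ≡ k × F ≼ S × ¬ Good F))
    from all (F , e , F≼S , bad) = bad (all F F≼S e)

  robustSize? : ∀ k → U.Decidable (RobustSize G k)
  robustSize? k = anyOfCard? (isRobust? k)

  private
    lookup≤card : ∀ {n} (F : Multiset n) i → lookup F i ≤ card F
    lookup≤card (x ∷ F) zero    = m≤m+n x (sum F)
    lookup≤card (x ∷ F) (suc i) = ≤-trans (lookup≤card F i) (m≤n+m (sum F) x)

    ∈-support⁺ : ∀ {n} (S : Multiset n) i → 0 < lookup S i → i ∈ support S
    ∈-support⁺ S i pos =
      lookup⇒[]= i _ (trans (lookup-map i _ S) (dec-true (0 <? lookup S i) pos))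

    ⊤-powerDominating : PowerDominating G ⊤
    ⊤-powerDominating =
      ⟶*-mono (λ _ → ∈-comprehension⁺ (inClosedNbhd? G ⊤) (inj₁ ∈⊤)) ε

    k≤card : ∀ n .{{_ : NonZero n}} k → k ≤ card (replicate n (suc k))
    k≤card (suc n) k = ≤-trans (n≤1+n k) (m≤m+n (suc k) _)

  replicate-isRobust : ∀ k → IsRobust G k (replicate order (suc k))
  replicate-isRobust k = k≤card order k , λ F _ e →
    ⊤ , (λ {i} _ → ∈-support⁺ (replicate order (suc k) ∖ F) i (pos F e i)) , ⊤-powerDominating
    where
    pos : ∀ F → card F ≡ k → ∀ i → 0 < lookup (replicate order (suc k) ∖ F) i
    pos F e i = subst (0 <_) (sym (lookup-zipWith _∸_ i (replicate order (suc k)) F))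
      (subst (λ m → 0 < m ∸ lookup F i) (sym (lookup-replicate i (suc k)))
        (m<n⇒0<n∸m (s≤s (≤-trans (lookup≤card F i) (≤-reflexive e)))))

  leastRobustSize : ∀ k → ∃ (IsLeast (RobustSize G k))
  leastRobustSize k = least (robustSize? k) _ (_ , refl , replicate-isRobust k)

  robustPowerDominationNumber : ℕ → ℕ
  robustPowerDominationNumber k = proj₁ (leastRobustSize k)

-- Equations (1) and (2) have the form x - 1 = k over the integers, where k ≥ 0;
-- they are written x = k + 1, since truncated subtraction would also admit
-- x = 0 for k = 0.  For 3 ≤ a ≤ b the subtractions a ∸ 3 and b ∸ 3 are exact.
JumpCondition : (a b k p : ℕ) → Set
JumpCondition a b k p = ∃[ qa ] ∃[ ra ] ∃[ qb ] ∃[ rb ]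
  ( p ≡ qa * a + ra + qb * b + rb
  × qa * a + ra + 2 * qb ≡ k + 1
  × qb * b + rb + 2 * qa ≡ k + 1
  × ra ≤ a ∸ 3
  × rb ≤ b ∸ 3 )

{-# OPTIONS --safe #-}
module Submission where

-- A set of vertices of K_{a,b} is power dominating iff it meets both sides or misses at most one
-- vertex of some side.  So S is k-robust iff no k removals can empty one side and also delete two
-- vertices of the other.  The two smallest of n multiplicities with total x have sum at most
-- f_n(x) = ⌊x/n⌋ + ⌊(x+1)/n⌋, attained by a balanced distribution, hence p_k is the least x + y with
-- k < y + f_a(x) and k < x + f_b(y).  As f_n is 1-Lipschitz, p_k + 1 ≤ p_{k+1} ≤ p_k + 2, and
-- one more sensor suffices unless both inequalities are tight and it leaves f_a and f_b unchanged
-- on either side, which is the Jump Condition.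

open import Defs
open import Data.Fin using (Fin; zero; suc; splitAt; _↑ˡ_; _↑ʳ_)
open import Data.Fin.Properties
  using (any?; ↑ˡ-injective; ↑ʳ-injective; splitAt-↑ˡ; splitAt-↑ʳ; splitAt⁻¹-↑ˡ; splitAt⁻¹-↑ʳ)
  renaming (_≟_ to _≟ᶠ_)
open import Data.Fin.Subset using (Subset; _∈_; _∉_; _⊆_; _∪_; ⁅_⁆; ⊤)
open import Data.Fin.Subset.Properties
  using (_∈?_; ∈⊤; p⊆p∪q; q⊆p∪q; x∈p∪q⁻; x∈⁅x⁆; x∈⁅y⁆⇒x≡y)
open import Data.Nat
  using (ℕ; zero; suc; _+_; _*_; _∸_; _≤_; _<_; z≤n; s≤s; s≤s⁻¹; NonZero; >-nonZero; _<?_; _≤?_; _/_; _%_)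
open import Data.Nat.DivMod
open import Data.Nat.Divisibility using (∣-refl; n∣m*n)
open import Data.Nat.Properties
open import Algebra.Properties.CommutativeSemigroup +-commutativeSemigroup using (x∙yz≈y∙xz)
open import Data.Nat.Solver using (module +-*-Solver)
open import Data.Product using (∃; ∃-syntax; _×_; _,_; proj₁; proj₂)
open import Data.Sum using (_⊎_; inj₁; inj₂)
open import Data.Vec as Vec using (Vec; []; _∷_; lookup; replicate; sum; _++_; _[_]≔_)
open import Data.Vec.Properties
  using (lookup⇒[]=; []=⇒lookup; lookup-map; lookup-zipWith; sum-++; lookup-++ˡ; lookup-++ʳ;
         lookup∘update; lookup∘update′)
open import Data.Vec.Relation.Binary.Pointwise.Inductive as Pointwise using ([]; _∷_)
open import Function using (_∘_)
open import Relation.Binary.Construct.Closure.ReflexiveTransitive using (Star; ε; _◅_)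
open import Relation.Binary.PropositionalEquality
  using (_≡_; _≢_; refl; sym; trans; cong; cong₂; subst; subst₂)
open import Relation.Nullary using (Dec; yes; no; ¬_; contradiction)
open import Relation.Nullary.Decidable using (¬?; decidable-stable; dec-true)

-- Arithmetic of the share function

-- The largest possible sum of the two smallest of n ≥ 2 multiplicities with total x.
pairShare : (n : ℕ) .{{_ : NonZero n}} → ℕ → ℕ
pairShare n x = x / n + suc x / n

[n+m]/n≡1+m/n : ∀ n m .{{_ : NonZero n}} → (n + m) / n ≡ suc (m / n)
[n+m]/n≡1+m/n n m = trans (+-distrib-/-∣ˡ m (∣-refl {n})) (cong (_+ m / n) (n/n≡1 n))

[q*n+r]/n≡q : ∀ q {n r} .{{_ : NonZero n}} → r < n → (q * n + r) / n ≡ q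
[q*n+r]/n≡q q {n} {r} r<n = trans (+-distrib-/-∣ˡ r (n∣m*n q))
  (trans (cong₂ _+_ (m*n/n≡m q n) (m<n⇒m/n≡0 r<n)) (+-identityʳ q))

pairShare-mono : ∀ n .{{_ : NonZero n}} {x y} → x ≤ y → pairShare n x ≤ pairShare n y
pairShare-mono n x≤y = +-mono-≤ (/-monoˡ-≤ n x≤y) (/-monoˡ-≤ n (s≤s x≤y))

module _ (c : ℕ) where

  private
    n : ℕ
    n = 2 + c

  -- Consecutive values have the term `suc x / n` in common, so the increment is `(2 + x) / n` minus
  -- `x / n`, at most 1 because `n ≥ 2`.
  pairShare-lipschitz : ∀ x → pairShare n (suc x) ≤ suc (pairShare n x)
  pairShare-lipschitz x = begin
    suc x / n + (2 + x) / n  ≤⟨ +-monoʳ-≤ (suc x / n) (/-monoˡ-≤ n (+-monoʳ-≤ 2 (m≤n+m x c))) ⟩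
    suc x / n + (n + x) / n  ≡⟨ cong (suc x / n +_) ([n+m]/n≡1+m/n n x) ⟩
    suc x / n + suc (x / n)  ≡⟨ +-suc (suc x / n) (x / n) ⟩
    suc (suc x / n + x / n)  ≡⟨ cong suc (+-comm (suc x / n) (x / n)) ⟩
    suc (pairShare n x)      ∎
    where open ≤-Reasoning

  pairShare-lipschitz-+ : ∀ t x → pairShare n (t + x) ≤ t + pairShare n x
  pairShare-lipschitz-+ zero    x = ≤-refl
  pairShare-lipschitz-+ (suc t) x =
    ≤-trans (pairShare-lipschitz (t + x)) (s≤s (pairShare-lipschitz-+ t x))

  pairShare-zero : pairShare n 0 ≡ 0
  pairShare-zero = cong₂ _+_ (0/n≡0 n) (m<n⇒m/n≡0 {1} {n} (s≤s (s≤s z≤n)))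

  pairShare-≤ : ∀ x → pairShare n x ≤ x
  pairShare-≤ x = subst₂ _≤_ (cong (pairShare n) (+-identityʳ x))
    (trans (cong (x +_) pairShare-zero) (+-identityʳ x)) (pairShare-lipschitz-+ x 0)

  pairShare-n+ : ∀ x → pairShare n (n + x) ≡ 2 + pairShare n x
  pairShare-n+ x = trans
    (cong₂ _+_ ([n+m]/n≡1+m/n n x)
      (trans (cong (_/ n) (sym (+-suc n x))) ([n+m]/n≡1+m/n n (suc x))))
    (cong suc (+-suc (x / n) (suc x / n)))

  -- Induction step for `pair≤pairShare`: raising all entries but the smallest by one adds `n - 1`
  -- to the total and must raise the share.
  pairShare-pred[n]+ : ∀ x → suc (pairShare n x) ≤ pairShare n (suc c + x)
  pairShare-pred[n]+ x = begin
    suc (x / n + suc x / n)        ≡⟨ +-comm (suc (x / n)) (suc x / n) ⟩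
    suc x / n + suc (x / n)        ≡⟨ cong (suc x / n +_) ([n+m]/n≡1+m/n n x) ⟨
    suc x / n + (n + x) / n        ≤⟨ +-monoˡ-≤ _ (/-monoˡ-≤ n (s≤s (m≤n+m x c))) ⟩
    (suc c + x) / n + (n + x) / n  ∎
    where open ≤-Reasoning

  -- Here `m` is the smallest entry and `m′` bounds the average of the other `n - 1` from below.
  -- With `m′ = m + d`, induction on `d` raises those `n - 1` entries by one, and induction on `m`
  -- raises all `n` entries, which adds exactly 2 to the share.
  pair≤pairShare : ∀ {m m′ x} → m ≤ m′ → m + suc c * m′ ≤ x → m + m′ ≤ pairShare n x
  pair≤pairShare {m} {m′} m≤m′ bound =
    subst (λ l → m + l ≤ _) (m+[n∸m]≡n m≤m′)
      (≤-trans (shifted m (m′ ∸ m))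
        (pairShare-mono n (subst (λ l → m + suc c * l ≤ _) (sym (m+[n∸m]≡n m≤m′)) bound)))
    where
    open ≤-Reasoning
    shifted : ∀ m d → m + (m + d) ≤ pairShare n (m + suc c * (m + d))
    shifted zero zero = z≤n
    shifted zero (suc d) = begin
      suc d                                    ≤⟨ s≤s (shifted zero d) ⟩
      suc (pairShare n (suc c * d))            ≤⟨ pairShare-pred[n]+ (suc c * d) ⟩
      pairShare n (suc c + suc c * d)          ≡⟨ cong (pairShare n) (*-suc (suc c) d) ⟨
      pairShare n (suc c * suc d)              ∎
    shifted (suc m) d = begin
      suc m + (suc m + d)                      ≡⟨ cong suc (+-suc m (m + d)) ⟩
      2 + (m + (m + d))                        ≤⟨ +-monoʳ-≤ 2 (shifted m d) ⟩
      2 + pairShare n (m + suc c * (m + d))    ≡⟨ pairShare-n+ _ ⟨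
      pairShare n (n + (m + suc c * (m + d)))  ≡⟨ cong (pairShare n) rearrange ⟩
      pairShare n (suc m + suc c * (suc m + d)) ∎
      where
      rearrange : n + (m + suc c * (m + d)) ≡ suc m + suc c * (suc m + d)
      rearrange = solve 3 (λ c m d →
        (con 2 :+ c) :+ (m :+ (con 1 :+ c) :* (m :+ d)) :=
        (con 1 :+ m) :+ (con 1 :+ c) :* ((con 1 :+ m) :+ d)) refl c m d
        where open +-*-Solver

  -- As `r ≤ n - 2`, both `q * n + r` and its successor lie below the next multiple of `n`, so each
  -- of the two quotients is `q`.
  pairShare-exact : ∀ q {r} → r ≤ c → pairShare n (q * n + r) ≡ 2 * q
  pairShare-exact q {r} r≤c = cong₂ _+_ ([q*n+r]/n≡q q (s≤s (m≤n⇒m≤1+n r≤c)))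
    (trans (cong (_/ n) (sym (+-suc (q * n) r)))
      (trans ([q*n+r]/n≡q q (s≤s (s≤s r≤c))) (sym (+-identityʳ q))))

  -- One more sensor replaces `x / n` by `(2 + x) / n`. If the remainder were at least `n - 2`, then
  -- `2 + x` would reach the next multiple of `n` and the share would grow. This is the source of
  -- the bounds on `ra` and `rb` in the Jump Condition.
  pairShare-flat⇒ : ∀ {x} → pairShare n (suc x) ≤ pairShare n x → x % n < c
  pairShare-flat⇒ {x} flat with x % n <? c
  ... | yes r<c = r<c
  ... | no  r≮c = contradiction flat (<⇒≱ grows)
    where
    open ≤-Reasoning
    reaches : n + x / n * n ≤ 2 + x
    reaches = begin
      n + x / n * n            ≤⟨ +-monoˡ-≤ (x / n * n) (+-monoʳ-≤ 2 (≮⇒≥ r≮c)) ⟩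
      2 + (x % n + x / n * n)  ≡⟨ cong (2 +_) (m≡m%n+[m/n]*n x n) ⟨
      2 + x                    ∎
    grows : pairShare n x < pairShare n (suc x)
    grows = begin
      suc (x / n) + suc x / n              ≡⟨ cong (λ q → suc q + suc x / n) (m*n/n≡m (x / n) n) ⟨
      suc (x / n * n / n) + suc x / n      ≡⟨ cong (_+ suc x / n) ([n+m]/n≡1+m/n n (x / n * n)) ⟨
      (n + x / n * n) / n + suc x / n      ≤⟨ +-monoˡ-≤ (suc x / n) (/-monoˡ-≤ n reaches) ⟩
      (2 + x) / n + suc x / n              ≡⟨ +-comm ((2 + x) / n) (suc x / n) ⟩
      pairShare n (suc x)                  ∎

-- The two smallest multiplicities

-- The sum bound stands in for minimality: the entries other than `i` average at least `lookup S j`,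
-- which is the form that `pair≤pairShare` takes. A new head is compared first with the second
-- smallest entry so far, then with the smallest.
twoSmallest : ∀ {c} (S : Vec ℕ (2 + c)) → ∃[ i ] ∃[ j ]
  (i ≢ j × lookup S i ≤ lookup S j × lookup S i + suc c * lookup S j ≤ sum S)
twoSmallest {zero} (x ∷ y ∷ []) with ≤-total x y
... | inj₁ x≤y = zero , suc zero , (λ ()) , x≤y , ≤-refl
... | inj₂ y≤x = suc zero , zero , (λ ()) , y≤x , ≤-reflexive
  (solve 2 (λ x y → y :+ (x :+ con 0) := x :+ (y :+ con 0)) refl x y)
  where open +-*-Solver
twoSmallest {suc c} (x ∷ S) with twoSmallest S
... | i , j , i≢j , Si≤Sj , bound with ≤-total (lookup S j) x
...   | inj₁ Sj≤x = suc i , suc j , (λ { refl → i≢j refl }) , Si≤Sj , (begin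
  lookup S i + (lookup S j + suc c * lookup S j)  ≡⟨ x∙yz≈y∙xz (lookup S i) (lookup S j) _ ⟩
  lookup S j + (lookup S i + suc c * lookup S j)  ≤⟨ +-mono-≤ Sj≤x bound ⟩
  x + sum S                                       ∎)
  where
  open ≤-Reasoning
...   | inj₂ x≤Sj with ≤-total x (lookup S i)
...     | inj₁ x≤Si = zero , suc i , (λ ()) , x≤Si , +-monoʳ-≤ x
  (≤-trans (+-monoʳ-≤ (lookup S i) (*-monoʳ-≤ (suc c) Si≤Sj)) bound)
...     | inj₂ Si≤x = suc i , zero , (λ ()) , Si≤x , (begin
  lookup S i + (x + suc c * x)           ≡⟨ x∙yz≈y∙xz (lookup S i) x _ ⟩
  x + (lookup S i + suc c * x)           ≤⟨ +-monoʳ-≤ x (+-monoʳ-≤ (lookup S i) (*-monoʳ-≤ (suc c) x≤Sj)) ⟩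
  x + (lookup S i + suc c * lookup S j)  ≤⟨ +-monoʳ-≤ x bound ⟩
  x + sum S                              ∎)
  where
  open ≤-Reasoning

-- Balanced distributions

module _ (n : ℕ) .{{_ : NonZero n}} where

  -- `floors x n` spreads `x` as evenly as possible over `n` places. The length `m` is separate from
  -- the divisor `n` to allow induction on it.
  floors : ℕ → (m : ℕ) → Vec ℕ m
  floors x zero    = []
  floors x (suc m) = x / n ∷ floors (suc x) m

  -- Both sides add the same `m + 1` consecutive floors, split off at the front or at the back. For
  -- `m = n` the appended floor exceeds the dropped one by exactly 1.
  sum-floors-suc : ∀ x m → x / n + sum (floors (suc x) m) ≡ sum (floors x m) + (m + x) / n
  sum-floors-suc x zero    = +-identityʳ (x / n)
  sum-floors-suc x (suc m) = trans
    (cong (x / n +_) (trans (sum-floors-suc (suc x) m)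
      (cong (λ y → sum (floors (suc x) m) + y / n) (+-suc m x))))
    (sym (+-assoc (x / n) _ _))

  -- Hermite's identity.
  sum-floors : ∀ x → sum (floors x n) ≡ x
  sum-floors zero = vanishing 0 n (≤-reflexive (+-identityʳ n))
    where
    vanishing : ∀ x m → m + x ≤ n → sum (floors x m) ≡ 0
    vanishing x zero    _ = refl
    vanishing x (suc m) h = cong₂ _+_ (m<n⇒m/n≡0 (≤-trans (s≤s (m≤n+m x m)) h))
      (vanishing (suc x) m (≤-trans (≤-reflexive (+-suc m x)) h))
  sum-floors (suc x) = +-cancelˡ-≡ (x / n) _ _ (trans (sum-floors-suc x n)
    (trans (cong₂ _+_ (sum-floors x) ([n+m]/n≡1+m/n n x)) (trans (+-comm x _) (sym (+-suc (x / n) x)))))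

  /≤lookup-floors : ∀ x m i → x / n ≤ lookup (floors x m) i
  /≤lookup-floors x (suc m) zero    = ≤-refl
  /≤lookup-floors x (suc m) (suc i) = ≤-trans (/-monoˡ-≤ n (n≤1+n x)) (/≤lookup-floors (suc x) m i)

  -- The entries are nondecreasing, so no pair has a smaller sum than the first two, whose sum is
  -- the share.
  pairShare≤floors : ∀ x m {i j} → i ≢ j →
    pairShare n x ≤ lookup (floors x m) i + lookup (floors x m) j
  pairShare≤floors x (suc m) {zero}  {zero}  i≢j = contradiction refl i≢j
  pairShare≤floors x (suc m) {zero}  {suc j} _   = +-monoʳ-≤ (x / n) (/≤lookup-floors (suc x) m j)
  pairShare≤floors x (suc m) {suc i} {zero}  _   =
    ≤-trans (+-monoʳ-≤ (x / n) (/≤lookup-floors (suc x) m i)) (≤-reflexive (+-comm (x / n) _))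
  pairShare≤floors x (suc m) {suc i} {suc j} i≢j =
    ≤-trans (pairShare-mono n (n≤1+n x)) (pairShare≤floors (suc x) m (i≢j ∘ cong suc))

-- Submultisets

lookup≤sum : ∀ {n} (F : Vec ℕ n) i → lookup F i ≤ sum F
lookup≤sum (x ∷ F) zero    = m≤m+n x (sum F)
lookup≤sum (x ∷ F) (suc i) = ≤-trans (lookup≤sum F i) (m≤n+m (sum F) x)

pair≤sum : ∀ {n} (F : Vec ℕ n) {i j} → i ≢ j → lookup F i + lookup F j ≤ sum F
pair≤sum (x ∷ F) {zero}  {zero}  i≢j = contradiction refl i≢j
pair≤sum (x ∷ F) {zero}  {suc j} _   = +-monoʳ-≤ x (lookup≤sum F j)
pair≤sum (x ∷ F) {suc i} {zero}  _   =
  ≤-trans (+-monoˡ-≤ x (lookup≤sum F i)) (≤-reflexive (+-comm (sum F) x))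
pair≤sum (x ∷ F) {suc i} {suc j} i≢j =
  ≤-trans (pair≤sum F (i≢j ∘ cong suc)) (m≤n+m (sum F) x)

sum-mono : ∀ {n} (S F : Vec ℕ n) → (∀ i → lookup S i ≤ lookup F i) → sum S ≤ sum F
sum-mono []      []      _   = z≤n
sum-mono (s ∷ S) (f ∷ F) S≤F = +-mono-≤ (S≤F zero) (sum-mono S F (S≤F ∘ suc))

sum-replicate-0 : ∀ n → sum (replicate n 0) ≡ 0
sum-replicate-0 zero    = refl
sum-replicate-0 (suc n) = sum-replicate-0 n

replicate-0-≼ : ∀ {n} (S : Multiset n) → replicate n 0 ≼ S
replicate-0-≼ []      = []
replicate-0-≼ (s ∷ S) = z≤n ∷ replicate-0-≼ S

[]≔-≼ : ∀ {n} {F S : Multiset n} {x} i → F ≼ S → x ≤ lookup S i → F [ i ]≔ x ≼ S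
[]≔-≼ zero    (_ ∷ F≼S)   x≤ = x≤ ∷ F≼S
[]≔-≼ (suc i) (f≤s ∷ F≼S) x≤ = f≤s ∷ []≔-≼ i F≼S x≤

sum-[]≔ : ∀ {n} (F : Vec ℕ n) i x → sum (F [ i ]≔ x) ≤ x + sum F
sum-[]≔ (f ∷ F) zero    x = +-monoʳ-≤ x (m≤n+m (sum F) f)
sum-[]≔ (f ∷ F) (suc i) x = ≤-trans (+-monoʳ-≤ f (sum-[]≔ F i x))
  (≤-reflexive (x∙yz≈y∙xz f x (sum F)))

-- The attack on two vertices of a side: starting from the empty multiset, the full multiplicities
-- at `i` and `j` are written in.
pairRestriction : ∀ {n} (S : Multiset n) {i j} → i ≢ j → ∃[ F ]
  (F ≼ S × card F ≤ lookup S i + lookup S j × lookup F i ≡ lookup S i × lookup F j ≡ lookup S j)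
pairRestriction {n} S {i} {j} i≢j =
  F₁ [ j ]≔ lookup S j
  , []≔-≼ j ([]≔-≼ i (replicate-0-≼ S) ≤-refl) ≤-refl
  , cardBound
  , trans (lookup∘update′ i≢j F₁ _) (lookup∘update i F₀ _)
  , lookup∘update j F₁ _
  where
  open ≤-Reasoning
  F₀ F₁ : Multiset n
  F₀ = replicate n 0
  F₁ = F₀ [ i ]≔ lookup S i
  cardBound : card (F₁ [ j ]≔ lookup S j) ≤ lookup S i + lookup S j
  cardBound = begin
    sum (F₁ [ j ]≔ lookup S j)            ≤⟨ sum-[]≔ F₁ j _ ⟩
    lookup S j + sum F₁                   ≤⟨ +-monoʳ-≤ (lookup S j) (sum-[]≔ F₀ i _) ⟩
    lookup S j + (lookup S i + sum F₀)    ≡⟨ cong (λ z → lookup S j + (lookup S i + z)) (sum-replicate-0 n) ⟩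
    lookup S j + (lookup S i + 0)         ≡⟨ cong (lookup S j +_) (+-identityʳ _) ⟩
    lookup S j + lookup S i               ≡⟨ +-comm (lookup S j) _ ⟩
    lookup S i + lookup S j               ∎

-- Greedy padding: if the whole tail of `S` still leaves room for `f`, take that tail and fill the
-- head up to `k`; otherwise keep the head at `f` and pad the tail.
≼-interpolate : ∀ {n} {F S : Multiset n} {k} → F ≼ S → card F ≤ k → k ≤ card S →
  ∃[ F′ ] (F ≼ F′ × F′ ≼ S × card F′ ≡ k)
≼-interpolate [] _ z≤n = [] , [] , [] , refl
≼-interpolate {F = f ∷ F} {s ∷ S} {k} (f≤s ∷ F≼S) F≤k k≤S with f + sum S ≤? k
... | yes f+S≤k =
  (k ∸ sum S) ∷ S
  , m+n≤o⇒m≤o∸n f f+S≤k ∷ F≼S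
  , m≤n+o⇒m∸n≤o k (sum S) (≤-trans k≤S (≤-reflexive (+-comm s (sum S)))) ∷ Pointwise.refl ≤-refl
  , m∸n+n≡m (≤-trans (m≤n+m (sum S) f) f+S≤k)
... | no  f+S≰k with ≼-interpolate F≼S
    (≤-trans (≤-reflexive (sym (m+n∸m≡n f (sum F)))) (∸-monoˡ-≤ f F≤k))
    (m≤n+o⇒m∸n≤o k f (≰⇒≥ f+S≰k))
...   | F′ , F≼F′ , F′≼S , e =
  f ∷ F′ , ≤-refl ∷ F≼F′ , f≤s ∷ F′≼S
  , trans (cong (f +_) e) (m+[n∸m]≡n (≤-trans (m≤m+n f (sum F)) F≤k))

∈-support-∖⁻ : ∀ {n} (S F : Multiset n) {v} → v ∈ support (S ∖ F) → lookup F v < lookup S v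
∈-support-∖⁻ S F {v} v∈ with lookup F v <? lookup S v
... | yes F<S = F<S
... | no  F≮S
  with () ← trans (sym (trans (lookup-map v _ (S ∖ F))
    (cong (λ m → Dec.does (0 <? m))
      (trans (lookup-zipWith _∸_ v S F) (m≤n⇒m∸n≡0 (≮⇒≥ F≮S)))))) ([]=⇒lookup v∈)

∈-support-∖⁺ : ∀ {n} (S F : Multiset n) {v} → lookup F v < lookup S v → v ∈ support (S ∖ F)
∈-support-∖⁺ S F {v} F<S = lookup⇒[]= v _ (trans (lookup-map v _ (S ∖ F))
  (dec-true (0 <? lookup (S ∖ F) v)
    (subst (0 <_) (sym (lookup-zipWith _∸_ v S F)) (m<n⇒0<n∸m F<S))))

-- Robust sets in complete bipartite graphs

-- A removal of fewer than `k` copies is padded to exactly `k`. The padded removal leaves a smaller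
-- support, so the power dominating set found there lies in the larger one too.
robust-∖ : ∀ (G : Graph) {k S F} → IsRobust G k S → F ≼ S → card F ≤ k →
  ContainsPowerDominating G (support (S ∖ F))
robust-∖ G {k} {S} {F} (k≤S , robust) F≼S F≤k with ≼-interpolate F≼S F≤k k≤S
... | F′ , F≼F′ , F′≼S , e with robust F′ F′≼S e
...   | T , T⊆ , dominating = T
  , (λ {v} v∈T → ∈-support-∖⁺ S F
      (≤-<-trans (Pointwise.lookup F≼F′ v) (∈-support-∖⁻ S F′ (T⊆ v∈T))))
  , dominating

-- Power domination with two completely joined independent sides

-- The sides are abstract predicates, so that every result can be applied a second time with `P` and
-- `Q` exchanged.
module _ (G : Graph) (P Q : Graph.Vertex G → Set) (side : ∀ v → P v ⊎ Q v)
         (joined : ∀ {u v} → P u → Q v → Graph.Adj G u v)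
         (P-independent : ∀ {u v} → P u → P v → ¬ Graph.Adj G u v)
         (Q-independent : ∀ {u v} → Q u → Q v → ¬ Graph.Adj G u v) where

  open Graph G

  private
    nbrOfP : ∀ {v w} → P w → Adj v w → Q v
    nbrOfP {v} Pw vw with side v
    ... | inj₁ Pv = contradiction vw (P-independent Pv Pw)
    ... | inj₂ Qv = Qv

    nbrOfQ : ∀ {v w} → Q v → Adj v w → P w
    nbrOfQ {w = w} Qv vw with side w
    ... | inj₁ Pw = Pw
    ... | inj₂ Qw = contradiction vw (Q-independent Qv Qw)

  -- Two unobserved twins are never forced.
  twins-stuck : ∀ {i j} → i ≢ j → P i → P j → ∀ {O} → i ∉ O → j ∉ O → ¬ Star (_⟶_ G) O ⊤
  twins-stuck i≢j Pi Pj i∉O j∉O ε = i∉O ∈⊤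
  twins-stuck {i} {j} i≢j Pi Pj {O} i∉O j∉O
      (force {v} {w} v∈O ((vw , w∉O) , unique) ◅ rest) =
    twins-stuck i≢j Pi Pj
      (avoids i∉O (λ { refl → i≢j (sym (unique j (adj-sym (joined Pj (nbrOfP Pi vw))) j∉O)) }))
      (avoids j∉O (λ { refl → i≢j (unique i (adj-sym (joined Pi (nbrOfP Pj vw))) i∉O) }))
      rest
    where
    avoids : ∀ {x} → x ∉ O → x ≢ w → x ∉ O ∪ ⁅ w ⁆
    avoids x∉O x≢w x∈ with x∈p∪q⁻ O ⁅ w ⁆ x∈
    ... | inj₁ x∈O = x∉O x∈O
    ... | inj₂ x∈w = x≢w (x∈⁅y⁆⇒x≡y w x∈w)

  -- Vertices of `P` have neighbors only in `Q`, which `T` avoids. Hence `i` and `j` start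
  -- unobserved and, being twins, stay so.
  ¬dominating-oneSide : ∀ {T i j} → (∀ {v} → Q v → v ∉ T) → i ≢ j → P i → P j →
    i ∉ T → j ∉ T → ¬ PowerDominating G T
  ¬dominating-oneSide {T} Q∉T i≢j Pi Pj i∉T j∉T =
    twins-stuck i≢j Pi Pj (unobserved Pi i∉T) (unobserved Pj j∉T)
    where
    unobserved : ∀ {x} → P x → x ∉ T → x ∉ N[_] G T
    unobserved Px x∉T x∈N with ∈-comprehension⁻ (inClosedNbhd? G T) x∈N
    ... | inj₁ x∈T            = x∉T x∈T
    ... | inj₂ (v , v∈T , vx) = Q∉T (nbrOfP Px vx) v∈T

  dominating-bothSides : ∀ {U p q} → P p → p ∈ U → Q q → q ∈ U → PowerDominating G U
  dominating-bothSides {U} {p} {q} Pp p∈U Qq q∈U =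
    -- Every vertex is already in the closed neighborhood; `⟶*-mono` at the empty run turns this
    -- inclusion into a run ending in `⊤`.
    ⟶*-mono G (λ {x} _ → ∈-comprehension⁺ (inClosedNbhd? G U) (inj₂ (observer x))) ε
    where
    observer : ∀ x → ∃[ v ] (v ∈ U × Adj v x)
    observer x with side x
    ... | inj₁ Px = q , q∈U , adj-sym (joined Px Qq)
    ... | inj₂ Qx = p , p∈U , joined Pp Qx

  -- The vertex `p` observes all of `Q`. At most one vertex of `P` is then unobserved, and `q`,
  -- observed and adjacent to it, forces it.
  dominating-oneSide : ∀ {U p q} → P p → p ∈ U → Q q →
    (∀ {i j} → P i → P j → i ∉ U → j ∉ U → i ≡ j) → PowerDominating G U
  dominating-oneSide {U} {p} {q} Pp p∈U Qq missing≡ with any? (λ w → ¬? (w ∈? N[_] G U))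
  ... | no  full = ⟶*-mono G
    (λ {x} _ → decidable-stable (x ∈? N[_] G U) (λ x∉N → full (x , x∉N))) ε
  ... | yes (w , w∉N) =
    force (Q⊆N Qq) ((adj-sym (joined Pw Qq) , w∉N) , λ _ _ → ≡w)
      ◅ ⟶*-mono G covered ε
    where
    U⊆N : U ⊆ N[_] G U
    U⊆N = ∈-comprehension⁺ (inClosedNbhd? G U) ∘ inj₁
    Q⊆N : ∀ {x} → Q x → x ∈ N[_] G U
    Q⊆N Qx = ∈-comprehension⁺ (inClosedNbhd? G U) (inj₂ (p , p∈U , joined Pp Qx))
    ∉N⇒P : ∀ {x} → x ∉ N[_] G U → P x
    ∉N⇒P {x} x∉N with side x
    ... | inj₁ Px = Px
    ... | inj₂ Qx = contradiction (Q⊆N Qx) x∉N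
    Pw : P w
    Pw = ∉N⇒P w∉N
    ≡w : ∀ {x} → x ∉ N[_] G U → x ≡ w
    ≡w x∉N = missing≡ (∉N⇒P x∉N) Pw (x∉N ∘ U⊆N) (w∉N ∘ U⊆N)
    covered : ⊤ ⊆ N[_] G U ∪ ⁅ w ⁆
    covered {x} _ with x ∈? N[_] G U
    ... | yes x∈N = p⊆p∪q ⁅ w ⁆ x∈N
    ... | no  x∉N = q⊆p∪q (N[_] G U) ⁅ w ⁆ (subst (_∈ ⁅ w ⁆) (sym (≡w x∉N)) (x∈⁅x⁆ w))

-- Robustness as two inequalities

-- The map `e` places one side among the vertices. Emptying two distinct places of a balanced side
-- costs at least the share, more than `F` spends there.
missing-unique : ∀ {c x m} (F : Vec ℕ (2 + c)) (e : Fin (2 + c) → Fin m) (U : Subset m) →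
  (∀ i → e i ∉ U → lookup (floors (2 + c) x (2 + c)) i ≤ lookup F i) →
  sum F < pairShare (2 + c) x →
  ∀ {i j} → e i ∉ U → e j ∉ U → i ≡ j
missing-unique {c} {x} F e U removed F<share {i} {j} i∉U j∉U with i ≟ᶠ j
... | yes i≡j = i≡j
... | no  i≢j = contradiction F<share (≤⇒≯ (begin
  pairShare (2 + c) x      ≤⟨ pairShare≤floors (2 + c) x (2 + c) i≢j ⟩
  lookup B i + lookup B j  ≤⟨ +-mono-≤ (removed i i∉U) (removed j j∉U) ⟩
  lookup F i + lookup F j  ≤⟨ pair≤sum F i≢j ⟩
  sum F                    ∎))
  where
  open ≤-Reasoning
  B = floors (2 + c) x (2 + c)

some-present : ∀ {c m} (e : Fin (2 + c) → Fin m) (U : Subset m) →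
  (∀ {i j} → e i ∉ U → e j ∉ U → i ≡ j) → ∃[ i ] e i ∈ U
some-present e U unique with e zero ∈? U | e (suc zero) ∈? U
... | yes 0∈U | _       = zero , 0∈U
... | no  _   | yes 1∈U = suc zero , 1∈U
... | no  0∉U | no  1∉U with () ← unique 0∉U 1∉U

-- x + y robust sensors, x on one side and y on the other, spread as evenly as possible.
Feasible : (a b : ℕ) .{{_ : NonZero a}} .{{_ : NonZero b}} → ℕ → ℕ → Set
Feasible a b k m = ∃[ x ] ∃[ y ] (x + y ≡ m × k < y + pairShare a x × k < x + pairShare b y)

module _ (c d : ℕ) where

  private
    a b : ℕ
    a = 2 + c
    b = 2 + d

    G : Graph
    G = completeBipartite a b

    open Graph G

    Left Right : Vertex → Set
    Left  v = ∃ λ (i : Fin a) → v ≡ i ↑ˡ b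
    Right v = ∃ λ (j : Fin b) → v ≡ a ↑ʳ j

    left-or-right : ∀ v → Left v ⊎ Right v
    left-or-right v with splitAt a v in eq
    ... | inj₁ i = inj₁ (i , sym (splitAt⁻¹-↑ˡ eq))
    ... | inj₂ j = inj₂ (j , sym (splitAt⁻¹-↑ʳ eq))

    right-or-left : ∀ v → Right v ⊎ Left v
    right-or-left v with left-or-right v
    ... | inj₁ l = inj₂ l
    ... | inj₂ r = inj₁ r

    left-right : ∀ {u v} → Left u → Right v → Adj u v
    left-right (i , refl) (j , refl) =
      subst₂ Opposite (sym (splitAt-↑ˡ a i b)) (sym (splitAt-↑ʳ a b j)) lr

    right-left : ∀ {u v} → Right u → Left v → Adj u v
    right-left {u} {v} Ru Lv = adj-sym {v} {u} (left-right Lv Ru)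

    left-independent : ∀ {u v} → Left u → Left v → ¬ Adj u v
    left-independent (i , refl) (j , refl) adj
      with () ← subst₂ Opposite (splitAt-↑ˡ a i b) (splitAt-↑ˡ a j b) adj

    right-independent : ∀ {u v} → Right u → Right v → ¬ Adj u v
    right-independent (i , refl) (j , refl) adj
      with () ← subst₂ Opposite (splitAt-↑ʳ a b i) (splitAt-↑ʳ a b j) adj

  -- If an inequality fails, `k` removals can delete one side entirely together with the two
  -- cheapest vertices of the other, and what is left is not power dominating.
  robust⇒bounds : ∀ {k} (SA : Vec ℕ a) (SB : Vec ℕ b) → IsRobust G k (SA ++ SB) →
    k < sum SB + pairShare a (sum SA) × k < sum SA + pairShare b (sum SB)
  robust⇒bounds {k} SA SB robust = ≰⇒> leftCheap , ≰⇒> rightCheap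
    where
    open ≤-Reasoning
    S : Multiset order
    S = SA ++ SB

    gone : ∀ {F v T} → T ⊆ support (S ∖ F) → lookup F v ≡ lookup S v → v ∉ T
    gone {F} T⊆ e v∈T = <-irrefl e (∈-support-∖⁻ S F (T⊆ v∈T))

    leftCheap : ¬ (sum SB + pairShare a (sum SA) ≤ k)
    leftCheap cheap with twoSmallest SA
    ... | i , j , i≢j , Si≤Sj , bound with pairRestriction SA i≢j
    ...   | FA , FA≼ , FA≤ , Fi , Fj
      with robust-∖ G {F = FA ++ SB} robust (Pointwise.++⁺ FA≼ (Pointwise.refl ≤-refl)) (begin
        sum (FA ++ SB)                     ≡⟨ sum-++ FA ⟩
        sum FA + sum SB                    ≤⟨ +-monoˡ-≤ (sum SB) FA≤ ⟩
        lookup SA i + lookup SA j + sum SB ≤⟨ +-monoˡ-≤ (sum SB) (pair≤pairShare c Si≤Sj bound) ⟩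
        pairShare a (sum SA) + sum SB      ≡⟨ +-comm _ (sum SB) ⟩
        sum SB + pairShare a (sum SA)      ≤⟨ cheap ⟩
        k                                  ∎)
    ...     | T , T⊆ , dominating =
      ¬dominating-oneSide G Left Right left-or-right left-right left-independent right-independent
        (λ { (l , refl) → gone T⊆ (trans (lookup-++ʳ FA SB l) (sym (lookup-++ʳ SA SB l))) })
        (i≢j ∘ ↑ˡ-injective b i j) (i , refl) (j , refl)
        (gone T⊆ (trans (lookup-++ˡ FA SB i) (trans Fi (sym (lookup-++ˡ SA SB i)))))
        (gone T⊆ (trans (lookup-++ˡ FA SB j) (trans Fj (sym (lookup-++ˡ SA SB j)))))
        dominating

    rightCheap : ¬ (sum SA + pairShare b (sum SB) ≤ k)
    rightCheap cheap with twoSmallest SB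
    ... | i , j , i≢j , Si≤Sj , bound with pairRestriction SB i≢j
    ...   | FB , FB≼ , FB≤ , Fi , Fj
      with robust-∖ G {F = SA ++ FB} robust (Pointwise.++⁺ (Pointwise.refl ≤-refl {SA}) FB≼) (begin
        sum (SA ++ FB)                       ≡⟨ sum-++ SA ⟩
        sum SA + sum FB                      ≤⟨ +-monoʳ-≤ (sum SA) FB≤ ⟩
        sum SA + (lookup SB i + lookup SB j) ≤⟨ +-monoʳ-≤ (sum SA) (pair≤pairShare d Si≤Sj bound) ⟩
        sum SA + pairShare b (sum SB)        ≤⟨ cheap ⟩
        k                                    ∎)
    ...     | T , T⊆ , dominating =
      ¬dominating-oneSide G Right Left right-or-left right-left right-independent left-independent
        (λ { (l , refl) → gone T⊆ (trans (lookup-++ˡ SA FB l) (sym (lookup-++ˡ SA SB l))) })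
        (i≢j ∘ ↑ʳ-injective a i j) (i , refl) (j , refl)
        (gone T⊆ (trans (lookup-++ʳ SA FB i) (trans Fi (sym (lookup-++ʳ SA SB i)))))
        (gone T⊆ (trans (lookup-++ʳ SA FB j) (trans Fj (sym (lookup-++ʳ SA SB j)))))
        dominating

  robust⇒feasible : ∀ {k m} → RobustSize G k m → Feasible a b k m
  robust⇒feasible (S , refl , robust) with Vec.splitAt a S
  ... | SA , SB , refl = sum SA , sum SB , sym (sum-++ SA) , robust⇒bounds SA SB robust

  -- Both sides are balanced. A removal that spares both leaves a dominating set; one that empties a
  -- side has spent all sensors there, so its remaining budget is below the share of the other side.
  feasible⇒robust : ∀ {k m} → Feasible a b k m → RobustSize G k m
  feasible⇒robust {k} {m} (x , y , x+y≡m , k<left , k<right) = S , card-S , k≤S , robust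
    where
    open ≤-Reasoning
    SA : Vec ℕ a
    SA = floors a x a
    SB : Vec ℕ b
    SB = floors b y b
    S : Multiset order
    S = SA ++ SB

    card-S : card S ≡ m
    card-S = trans (sum-++ SA) (trans (cong₂ _+_ (sum-floors a x) (sum-floors b y)) x+y≡m)

    k≤S : k ≤ card S
    k≤S = begin
      k                   ≤⟨ <⇒≤ k<right ⟩
      x + pairShare b y   ≤⟨ +-monoʳ-≤ x (pairShare-≤ d y) ⟩
      x + y               ≡⟨ trans x+y≡m (sym card-S) ⟩
      card S              ∎

    robust : ∀ F → F ≼ S → card F ≡ k → ContainsPowerDominating G (support (S ∖ F))
    robust F _ F≡k with Vec.splitAt a F
    ... | FA , FB , refl = U , (λ v∈U → v∈U) , dominating
      where
      U : Subset order
      U = support (S ∖ (FA ++ FB))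

      ∉U⇒≤ : ∀ {v} → v ∉ U → lookup S v ≤ lookup (FA ++ FB) v
      ∉U⇒≤ v∉U = ≮⇒≥ (v∉U ∘ ∈-support-∖⁺ S (FA ++ FB))

      leftRemoved : ∀ i → i ↑ˡ b ∉ U → lookup SA i ≤ lookup FA i
      leftRemoved i i∉U = subst₂ _≤_ (lookup-++ˡ SA SB i) (lookup-++ˡ FA FB i) (∉U⇒≤ i∉U)

      rightRemoved : ∀ j → a ↑ʳ j ∉ U → lookup SB j ≤ lookup FB j
      rightRemoved j j∉U = subst₂ _≤_ (lookup-++ʳ SA SB j) (lookup-++ʳ FA FB j) (∉U⇒≤ j∉U)

      FA+FB≡k : sum FA + sum FB ≡ k
      FA+FB≡k = trans (sym (sum-++ FA)) F≡k

      dominating : PowerDominating G U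
      dominating with any? (λ i → i ↑ˡ b ∈? U) | any? (λ j → a ↑ʳ j ∈? U)
      ... | yes (i , i∈U) | yes (j , j∈U) =
        dominating-bothSides G Left Right left-or-right left-right left-independent right-independent
          (i , refl) i∈U (j , refl) j∈U
      -- At most one left vertex is missing, so `some-present` finds one in `U`; the right vertex
      -- with index `zero` does the forcing.
      ... | _ | no noRight =
        dominating-oneSide G Left Right left-or-right left-right left-independent right-independent
          (_ , refl) (proj₂ (some-present (_↑ˡ b) U unique)) (zero , refl)
          λ { (i , refl) (j , refl) i∉U j∉U → cong (_↑ˡ b) (unique i∉U j∉U) }
        where
        FA<share : sum FA < pairShare a x
        FA<share = +-cancelˡ-< y _ _ (begin-strict
          y + sum FA         ≡⟨ cong (_+ sum FA) (sum-floors b y) ⟨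
          sum SB + sum FA    ≤⟨ +-monoˡ-≤ (sum FA)
                                  (sum-mono SB FB (λ j → rightRemoved j (λ j∈U → noRight (j , j∈U)))) ⟩
          sum FB + sum FA    ≡⟨ trans (+-comm (sum FB) (sum FA)) FA+FB≡k ⟩
          k                  <⟨ k<left ⟩
          y + pairShare a x  ∎)
        unique : ∀ {i j} → i ↑ˡ b ∉ U → j ↑ˡ b ∉ U → i ≡ j
        unique = missing-unique FA (_↑ˡ b) U leftRemoved FA<share
      ... | no noLeft | yes _ =
        dominating-oneSide G Right Left right-or-left right-left right-independent left-independent
          (_ , refl) (proj₂ (some-present (a ↑ʳ_) U unique)) (zero , refl)
          λ { (i , refl) (j , refl) i∉U j∉U → cong (a ↑ʳ_) (unique i∉U j∉U) }
        where
        FB<share : sum FB < pairShare b y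
        FB<share = +-cancelˡ-< x _ _ (begin-strict
          x + sum FB         ≡⟨ cong (_+ sum FB) (sum-floors a x) ⟨
          sum SA + sum FB    ≤⟨ +-monoˡ-≤ (sum FB)
                                  (sum-mono SA FA (λ i → leftRemoved i (λ i∈U → noLeft (i , i∈U)))) ⟩
          sum FA + sum FB    ≡⟨ FA+FB≡k ⟩
          k                  <⟨ k<right ⟩
          x + pairShare b y  ∎)
        unique : ∀ {i j} → a ↑ʳ i ∉ U → a ↑ʳ j ∉ U → i ≡ j
        unique = missing-unique FB (a ↑ʳ_) U rightRemoved FB<share

-- The effect of one more removal

-- Dropping one sensor lowers the bound of the opposite side by 1 and, by the Lipschitz property,
-- that of its own side by at most 1.
feasible-pred : ∀ c d {k m} → Feasible (2 + c) (2 + d) (suc k) m →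
  ∃[ m′ ] (suc m′ ≡ m × Feasible (2 + c) (2 + d) k m′)
feasible-pred c d {k} (zero , zero , refl , lt , _) with () ← subst (suc k <_) (pairShare-zero c) lt
feasible-pred c d {k} (suc x , y , refl , k<left , k<right) =
  x + y , refl , x , y , refl
  , s≤s⁻¹ (≤-trans k<left (≤-trans (+-monoʳ-≤ y (pairShare-lipschitz c x)) (≤-reflexive (+-suc y _))))
  , s≤s⁻¹ k<right
feasible-pred c d {k} (zero , suc y , refl , k<left , k<right) =
  y , refl , zero , y , refl , s≤s⁻¹ k<left , s≤s⁻¹ (≤-trans k<right (pairShare-lipschitz d y))

feasible-suc-+2 : ∀ {a b k m} .{{_ : NonZero a}} .{{_ : NonZero b}} →
  Feasible a b k m → Feasible a b (suc k) (2 + m)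
feasible-suc-+2 {a} {b} (x , y , refl , k<left , k<right) =
  suc x , suc y , cong suc (+-suc x y)
  , s≤s (≤-trans k<left (+-monoʳ-≤ y (pairShare-mono a (n≤1+n x))))
  , s≤s (≤-trans k<right (+-monoʳ-≤ x (pairShare-mono b (n≤1+n y))))

-- An extra sensor on one side raises the opposite bound by 1, so it fails only through its own
-- side. If both placements fail, both bounds are tight and both shares are flat.
feasible-suc-+1 : ∀ c d {k m} → ¬ JumpCondition (3 + c) (3 + d) k m →
  Feasible (3 + c) (3 + d) k m → Feasible (3 + c) (3 + d) (suc k) (1 + m)
feasible-suc-+1 c d {k} noJump (x , y , refl , k<left , k<right)
  with suc k <? y + pairShare (3 + c) (suc x) | suc k <? x + pairShare (3 + d) (suc y)
... | yes k+1<left | _ = suc x , y , refl , k+1<left , s≤s k<right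
... | no _ | yes k+1<right = x , suc y , +-suc x y , s≤s k<left , k+1<right
... | no left≤ | no right≤ = contradiction jump noJump
  where
  a b : ℕ
  a = 3 + c
  b = 3 + d

  tight : ∀ {s t u} → k < u + s → ¬ suc k < u + t → t ≤ s
  tight {u = u} k< ≮k = +-cancelˡ-≤ u _ _ (≤-trans (≮⇒≥ ≮k) k<)

  flatˣ : x % a < suc c
  flatˣ = pairShare-flat⇒ (suc c) {x} (tight {u = y} k<left left≤)

  flatʸ : y % b < suc d
  flatʸ = pairShare-flat⇒ (suc d) {y} (tight {u = x} k<right right≤)

  divide : ∀ z n .{{_ : NonZero n}} → z / n * n + z % n ≡ z
  divide z n = trans (+-comm (z / n * n) _) (sym (m≡m%n+[m/n]*n z n))

  shareˣ : pairShare a x ≡ 2 * (x / a)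
  shareˣ = trans (cong (pairShare a) (sym (divide x a)))
    (pairShare-exact (suc c) (x / a) (<⇒≤ flatˣ))

  shareʸ : pairShare b y ≡ 2 * (y / b)
  shareʸ = trans (cong (pairShare b) (sym (divide y b)))
    (pairShare-exact (suc d) (y / b) (<⇒≤ flatʸ))

  equation : ∀ {u v w} → u ≡ w → ∀ {s t} → s ≡ v → k < w + s → s ≤ t → ¬ suc k < w + t → u + v ≡ k + 1
  equation refl refl k< s≤t ≮k = trans
    (≤-antisym (≤-trans (+-monoʳ-≤ _ s≤t) (≮⇒≥ ≮k)) k<) (+-comm 1 k)

  jump : JumpCondition a b k (x + y)
  -- Quotients and remainders are the witnesses. The tight right bound yields equation (1), the
  -- tight left bound equation (2), and flatness the bounds on the remainders.
  jump = x / a , x % a , y / b , y % b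
    , trans (cong₂ _+_ (sym (divide x a)) (sym (divide y b))) (sym (+-assoc (x / a * a + x % a) _ _))
    , equation (divide x a) shareʸ k<right (pairShare-mono b (n≤1+n y)) right≤
    , equation (divide y b) shareˣ k<left (pairShare-mono a (n≤1+n x)) left≤
    , s≤s⁻¹ flatˣ , s≤s⁻¹ flatʸ

-- With t + 1 more sensors on one side, its share grows only by t, since the first one is wasted.
wasted : ∀ c q {r k x′ y y′} → r ≤ c → y + 2 * q ≡ k → x′ + y′ ≡ suc (q * (3 + c) + r + y) →
  q * (3 + c) + r < x′ → y′ + pairShare (3 + c) x′ ≤ k
wasted c q {r} {k} {x′} {y} {y′} r≤c refl total more = begin
  y′ + pairShare a x′              ≡⟨ cong (λ z → y′ + pairShare a z) x′≡ ⟨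
  y′ + pairShare a (t + suc x)     ≤⟨ +-monoʳ-≤ y′ (pairShare-lipschitz-+ (suc c) t (suc x)) ⟩
  y′ + (t + pairShare a (suc x))   ≡⟨ +-assoc y′ t _ ⟨
  y′ + t + pairShare a (suc x)     ≡⟨ cong₂ _+_ y′+t≡y share ⟩
  y + 2 * q                        ∎
  where
  open ≤-Reasoning
  a x t : ℕ
  a = 3 + c
  x = q * a + r
  t = x′ ∸ suc x
  x′≡ : t + suc x ≡ x′
  x′≡ = m∸n+n≡m more
  share : pairShare a (suc x) ≡ 2 * q
  share = trans (cong (pairShare a) (sym (+-suc (q * a) r))) (pairShare-exact (suc c) q (s≤s r≤c))
  y′+t≡y : y′ + t ≡ y
  y′+t≡y = +-cancelˡ-≡ (suc x) _ _ (trans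
    (solve 3 (λ x y′ t → x :+ (y′ :+ t) := (t :+ x) :+ y′) refl (suc x) y′ t)
    (trans (cong (_+ y′) x′≡) total))
    where open +-*-Solver

-- With one sensor more in total, some side holds more than its part `q * n + r` in the Jump
-- Condition. By `wasted`, the bound attached to that side then stays at most `k + 1`.
jump⇒¬feasible : ∀ c d {k m} → JumpCondition (3 + c) (3 + d) k m →
  ¬ Feasible (3 + c) (3 + d) (suc k) (1 + m)
jump⇒¬feasible c d {k} (qa , ra , qb , rb , refl , eqa , eqb , ra≤ , rb≤)
    (x′ , y′ , total , k<left , k<right)
  with qa * (3 + c) + ra <? x′ | qb * (3 + d) + rb <? y′
... | yes more | _ = contradiction k<left (≤⇒≯
  (wasted c qa ra≤ (trans eqb (+-comm k 1)) total′ more))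
  where
  total′ = trans total (cong suc (+-assoc (qa * (3 + c) + ra) _ _))
... | no _ | yes more = contradiction k<right (≤⇒≯
  (wasted d qb rb≤ (trans eqa (+-comm k 1)) total′ more))
  where
  total′ = trans (+-comm y′ x′) (trans total
    (cong suc (trans (+-assoc (qa * (3 + c) + ra) _ _) (+-comm (qa * (3 + c) + ra) _))))
... | no ≮x′ | no ≮y′ = contradiction (+-mono-≤ (≮⇒≥ ≮x′) (≮⇒≥ ≮y′))
  (<⇒≱ (≤-reflexive (sym (trans total (cong suc (+-assoc (qa * (3 + c) + ra) _ _))))))

-- Abstract in G: at a concrete graph, conversion checking would unfold the search for p k.
robust-recurrence : ∀ c d (G : Graph) →
  (∀ {k m} → RobustSize G k m → Feasible (3 + c) (3 + d) k m) →
  (∀ {k m} → Feasible (3 + c) (3 + d) k m → RobustSize G k m) →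
  let p = robustPowerDominationNumber G in ∀ k →
  (JumpCondition (3 + c) (3 + d) k (p k) → p (suc k) ≡ p k + 2) ×
  (¬ JumpCondition (3 + c) (3 + d) k (p k) → p (suc k) ≡ p k + 1)
robust-recurrence c d G toFeasible toRobust k =
    (λ jump → trans (≤-antisym p[k+1]≤p[k]+2 (≤∧≢⇒< p[k]<p[k+1] λ e →
        jump⇒¬feasible c d jump (subst (Feasible (3 + c) (3 + d) (suc k)) (sym e) (feasible-p (suc k)))))
      (+-comm 2 (p k)))
  , (λ noJump → trans (≤-antisym
        (p≤ (suc k) (feasible-suc-+1 c d noJump (feasible-p k))) p[k]<p[k+1])
      (+-comm 1 (p k)))
  where
  p : ℕ → ℕ
  p = robustPowerDominationNumber G

  feasible-p : ∀ l → Feasible (3 + c) (3 + d) l (p l)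
  feasible-p l = toFeasible (proj₁ (proj₂ (leastRobustSize G l)))

  p≤ : ∀ l {m} → Feasible (3 + c) (3 + d) l m → p l ≤ m
  p≤ l feasible = proj₂ (proj₂ (leastRobustSize G l)) _ (toRobust feasible)

  p[k]<p[k+1] : p k < p (suc k)
  p[k]<p[k+1] with feasible-pred (suc c) (suc d) (feasible-p (suc k))
  ... | m , e , feasible = ≤-trans (s≤s (p≤ k feasible)) (≤-reflexive e)

  p[k+1]≤p[k]+2 : p (suc k) ≤ 2 + p k
  p[k+1]≤p[k]+2 = p≤ (suc k) (feasible-suc-+2 (feasible-p k))

theorem4 :
    (a b : ℕ) (3≤a : 3 ≤ a) (a≤b : a ≤ b) →
    let G = completeBipartite a b {{ >-nonZero (m<n⇒0<n 3≤a) }}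
        p = robustPowerDominationNumber G
    in (k : ℕ) →
       (JumpCondition a b k (p k) → p (suc k) ≡ p k + 2) ×
       (¬ JumpCondition a b k (p k) → p (suc k) ≡ p k + 1)
theorem4 (suc (suc (suc c))) (suc (suc (suc d))) 3≤a@(s≤s (s≤s (s≤s _))) (s≤s (s≤s (s≤s _))) =
  robust-recurrence c d (completeBipartite _ _ {{ >-nonZero (m<n⇒0<n 3≤a) }})
    (robust⇒feasible (suc c) (suc d)) (feasible⇒robust (suc c) (suc d))
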